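{- For all integers $m\ge 2$ and $t\ge 1$, the group $$J_{m,t}=C_m^{\,3t}\oplus C_{2m}^{\,4t}\oplus C_{6m}^{\,t}$$ satisfies $$\delta(J_{m,t})\ge tm=\frac{\mathsf r(J_{m,t})\exp(J_{m,t})}{48}.$$
   Context: Groups are finite, abelian and written additively; $C_n$ denotes the cyclic group of order $n$. The rank $\mathsf r(G)$ is the minimum number of generators of $G$, and $\exp(G)$ is the exponent of $G$. A sequence over $G$ is a finite unordered multiset of elements of $G$; it is zero-sum free if no nonempty sub-multiset has sum $0$. $\mathsf d(G)$ is the maximum length (counted with multiplicity) of a zero-sum-free sequence over $G$. If $G\cong C_{n_1}\oplus\cdots\oplus C_{n_s}$ with $1<n_1\mid\cdots\mid n_s$, then $\mathsf d^*(G)=\sum_{i=1}^s(n_i-1)$. The Davenport excess is $\delta(G)=\mathsf d(G)-\mathsf d^*(G)$. -}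

module Defs where

open import Algebra.Bundles using (AbelianGroup)
import Algebra.Construct.DirectProduct as DirectProduct
import Algebra.Construct.Terminal as Terminal
import Algebra.Definitions.RawMonoid as RawMonoidDefs
open import Algebra.Morphism.Structures using (module GroupMorphisms)
open import Data.Integer.Base as ℤ using (ℤ; +_; _-_)
import Data.Integer.Properties as ℤ
open import Data.Integer.Divisibility.Signed using (divides; ∣m∣n⇒∣m+n; ∣m⇒∣-m)
  renaming (_∣_ to _∣ᶻ_)
open import Data.Integer.Tactic.RingSolver using (solve-∀)
open import Data.List.Base using (List; []; foldr; length; map)
import Data.List.Base as List
import Data.List.Membership.Setoid as SetoidMembership
open import Data.List.Relation.Binary.Sublist.Propositional using (_⊆_)
open import Data.List.Relation.Unary.All using (All)
open import Data.List.Relation.Unary.Linked using (Linked)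
open import Data.Nat.Base using (ℕ; zero; suc; pred; _*_; _≤_; _<_)
open import Data.Nat.Divisibility using (_∣_)
open import Data.Product.Base using (Σ-syntax; ∃-syntax; _×_; _,_)
open import Level using (0ℓ)
open import Relation.Binary.PropositionalEquality
  using (_≡_; _≢_; refl; subst)
open import Relation.Nullary.Negation using (¬_)

Abelian : Set₁
Abelian = AbelianGroup 0ℓ 0ℓ

record _≡_[mod_] (x y : ℤ) (n : ℕ) : Set where
  constructor congruent
  field difference : (+ n) ∣ᶻ (x - y)

-- ℤ with congruence modulo n as its equality, i.e. ℤ/nℤ: the cyclic group of
-- order n for n ≥ 1 (C 0 would be ℤ itself).
C : ℕ → Abelian
C n = record
  { Carrier = ℤ
  ; _≈_     = λ x y → x ≡ y [mod n ]
  ; _∙_     = ℤ._+_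
  ; ε       = ℤ.0ℤ
  ; _⁻¹     = ℤ.-_
  ; isAbelianGroup = record
    { isGroup = record
      { isMonoid = record
        { isSemigroup = record
          { isMagma = record
            { isEquivalence = record
              { refl  = reflexive refl
              ; sym   = λ { {x} {y} (congruent p) → congruent
                          (subst ((+ n) ∣ᶻ_) (neg-diff x y) (∣m⇒∣-m p)) }
              ; trans = λ { {x} {y} {z} (congruent p) (congruent q) → congruent
                          (subst ((+ n) ∣ᶻ_) (add-diff x y z) (∣m∣n⇒∣m+n p q)) }
              }
            ; ∙-cong = λ { {x} {y} {u} {v} (congruent p) (congruent q) → congruent
                         (subst ((+ n) ∣ᶻ_) (diff-add x y u v) (∣m∣n⇒∣m+n p q)) }
            }
          ; assoc = λ x y z → reflexive (ℤ.+-assoc x y z)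
          }
        ; identity = (λ x → reflexive (ℤ.+-identityˡ x))
                   , (λ x → reflexive (ℤ.+-identityʳ x))
        }
      ; inverse = (λ x → reflexive (ℤ.+-inverseˡ x))
                , (λ x → reflexive (ℤ.+-inverseʳ x))
      ; ⁻¹-cong = λ { {x} {y} (congruent p) → congruent
                    (subst ((+ n) ∣ᶻ_) (diff-neg x y) (∣m⇒∣-m p)) }
      }
    ; comm = λ x y → reflexive (ℤ.+-comm x y)
    }
  }
  where
  reflexive : ∀ {x y} → x ≡ y → x ≡ y [mod n ]
  reflexive {x} refl = congruent (divides ℤ.0ℤ (ℤ.+-inverseʳ x))

  neg-diff : ∀ x y → ℤ.- (x - y) ≡ y - x
  neg-diff = solve-∀

  add-diff : ∀ x y z → (x - y) ℤ.+ (y - z) ≡ x - z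
  add-diff = solve-∀

  diff-add : ∀ x y u v → (x - y) ℤ.+ (u - v) ≡ (x ℤ.+ u) - (y ℤ.+ v)
  diff-add = solve-∀

  diff-neg : ∀ x y → ℤ.- (x - y) ≡ (ℤ.- x) - (ℤ.- y)
  diff-neg = solve-∀

infixr 6 _⊕_
infixl 8 _^⊕_

𝟘 : Abelian
𝟘 = Terminal.abelianGroup

_⊕_ : Abelian → Abelian → Abelian
_⊕_ = DirectProduct.abelianGroup

_^⊕_ : Abelian → ℕ → Abelian
G ^⊕ zero  = 𝟘
G ^⊕ suc k = G ⊕ (G ^⊕ k)

⨁C : List ℕ → Abelian
⨁C = foldr (λ n H → C n ⊕ H) 𝟘

_≅_ : Abelian → Abelian → Set
G ≅ H = ∃[ f ] GroupMorphisms.IsGroupIsomorphism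
                 (AbelianGroup.rawGroup G) (AbelianGroup.rawGroup H) f

IsLeast : (ℕ → Set) → ℕ → Set
IsLeast P n = P n × (∀ k → P k → n ≤ k)

IsGreatest : (ℕ → Set) → ℕ → Set
IsGreatest P n = P n × (∀ k → P k → k ≤ n)

module _ (G : Abelian) where
  open AbelianGroup G using (Carrier; _≈_; _∙_; ε; _⁻¹; rawMonoid; setoid)
  open RawMonoidDefs rawMonoid using () renaming (_×_ to _·_)
  open SetoidMembership setoid using (_∈_)

  σ : List Carrier → Carrier
  σ = foldr _∙_ ε

  -- A sequence over G is a multiset, represented by a list in any order.  The
  -- sublists of the list are, up to order, exactly its sub-multisets, and σ
  -- does not depend on the order.
  ZeroSumFree : List Carrier → Set
  ZeroSumFree xs = ∀ {ys} → ys ⊆ xs → ys ≢ [] → ¬ (σ ys ≈ ε)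

  Is-d : ℕ → Set
  Is-d = IsGreatest λ k → Σ[ xs ∈ List Carrier ] length xs ≡ k × ZeroSumFree xs

  data ⟨_⟩ (gs : List Carrier) : Carrier → Set where
    generator : ∀ {x} → x ∈ gs → ⟨ gs ⟩ x
    identity∈ : ⟨ gs ⟩ ε
    product∈  : ∀ {x y} → ⟨ gs ⟩ x → ⟨ gs ⟩ y → ⟨ gs ⟩ (x ∙ y)
    inverse∈  : ∀ {x} → ⟨ gs ⟩ x → ⟨ gs ⟩ (x ⁻¹)
    resp∈     : ∀ {x y} → x ≈ y → ⟨ gs ⟩ x → ⟨ gs ⟩ y

  IsRank : ℕ → Set
  IsRank = IsLeast λ k →
    Σ[ gs ∈ List Carrier ] length gs ≡ k × (∀ x → ⟨ gs ⟩ x)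

  IsExponent : ℕ → Set
  IsExponent = IsLeast λ e → 0 < e × (∀ x → e · x ≈ ε)

  -- The invariant factors ns of a finite abelian group are unique, so d*(G)
  -- is a single number.
  Is-d* : ℕ → Set
  Is-d* k = Σ[ ns ∈ List ℕ ]
    All (1 <_) ns × Linked _∣_ ns × G ≅ ⨁C ns × k ≡ List.sum (map pred ns)

  IsDavenportExcess : ℤ → Set
  IsDavenportExcess δ = ∃[ d ] ∃[ d* ] Is-d d × Is-d* d* × δ ≡ + d - + d*

J : ℕ → ℕ → Abelian
J m t = C m ^⊕ (3 * t) ⊕ C (2 * m) ^⊕ (4 * t) ⊕ C (6 * m) ^⊕ t

-- Write a finite abelian group as ℤⁿ/L and consider the sequence in which the
-- i-th unit vector occurs bᵢ − 1 times.  It is zero-sum free iff the box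
-- ∏ [0, bᵢ) meets L only in 0.  In that case ∏ [0, m bᵢ) meets mL only in 0,
-- since a point m x of it has x in the first box; so multiplicities m bᵢ − 1 give
-- a zero-sum free sequence over ℤⁿ/mL.  A zero-sum free sequence of length 10
-- with 8 distinct elements over C_2⁴ ⊕ C_6 = ℤ⁸/L thus becomes one of length
-- 18m − 8 over ℤ⁸/mL = C_m³ ⊕ C_{2m}⁴ ⊕ C_{6m}, whose d* is 17m − 8, and
-- direct sums multiply both numbers by t.  The maximum d exists because zero-sum
-- freeness is decidable and, by the pigeonhole principle on prefix sums, bounds
-- the length.  For the rank, J maps onto C_m^{8t}, which has m^{8t} elements,
-- while k elements generate at most m^k elements there.

module Submission where

open import Defs

open import Algebra.Bundles using (AbelianGroup)
import Algebra.Definitions.RawMonoid as RawMonoidDefs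
import Algebra.Morphism.Construct.Composition as Compose
open import Algebra.Morphism.Structures using (module GroupMorphisms)
import Algebra.Properties.AbelianGroup as AbelianGroupProperties
import Algebra.Properties.CommutativeSemigroup as CommutativeSemigroupProperties
import Algebra.Properties.Monoid.Mult as Mult
open import Data.Fin using (#_)
open import Data.Fin.Base as Fin using (Fin; fromℕ<; toℕ; combine; remQuot)
import Data.Fin.Properties as Fin
open import Data.Integer.Base as ℤ using (ℤ; +_; -[1+_]; +≤+) renaming (_≥_ to _≥ᶻ_)
open import Data.Integer.Divisibility.Signed using (divides; ∣⇒∣ᵤ; ∣ᵤ⇒∣)
import Data.Integer.Divisibility.Signed as ℤᵈ
open import Data.Integer.DivMod using (_%ℕ_; _/ℕ_; n%ℕd<d; a≡a%ℕn+[a/ℕn]*n)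
import Data.Integer.Properties as ℤ
import Data.Integer.Tactic.RingSolver as ℤ-Solver
open import Data.List.Base using (List; []; _∷_; _++_; length; map; replicate; take)
open import Data.List.Properties using (length-map; length-++; length-replicate)
open import Data.List.Relation.Binary.Pointwise as Pointwise using (Pointwise; []; _∷_)
open import Data.List.Relation.Binary.Sublist.Propositional using (_⊆_; []; _∷ʳ_; _∷_)
open import Data.List.Relation.Binary.Sublist.Propositional.Properties using (take-⊆)
open import Data.List.Relation.Unary.All using (All; []; _∷_)
import Data.List.Relation.Unary.All.Properties as All
open import Data.List.Relation.Unary.Any using (here; there)
open import Data.List.Membership.Setoid.Properties using (∈-map⁺; ∈-++⁺ˡ; ∈-++⁺ʳ)
import Data.List.Membership.Setoid as SetoidMembership
open import Data.List.Relation.Unary.AllPairs using (AllPairs; []; _∷_)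
import Data.List.Relation.Unary.AllPairs.Properties as AllPairs
open import Data.List.Relation.Unary.Linked using (Linked)
import Data.List.Relation.Unary.Linked.Properties as Linked
open import Data.Nat.Base
  using (ℕ; zero; suc; pred; _+_; _*_; _^_; _≤_; _<_; _≥_; z≤n; s≤s; NonZero)
import Data.Nat.Base as ℕ
open import Data.Nat.Divisibility using (_∣_)
import Data.Nat.Divisibility as ℕᵈ
import Data.Nat.DivMod as ℕ
open import Data.Nat.ListAction using (sum)
import Data.Nat.Properties as ℕ
open import Data.Nat.Tactic.RingSolver using (solve-∀)
open import Data.Product.Base using (Σ-syntax; ∃; ∃-syntax; _×_; _,_; proj₁; proj₂)
open import Data.Product.Function.NonDependent.Setoid using (_×-inverse_)
open import Data.Product.Relation.Binary.Pointwise.NonDependent using (Pointwise-≡↔≡)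
open import Data.Rational.Base using (_/_)
import Data.Rational.Properties as ℚ
import Data.Rational.Unnormalised.Base as ℚᵘ
open import Data.Sum.Base using (inj₁; inj₂)
open import Data.Vec.Base as Vec using (Vec; []; _∷_)
import Data.Vec.Properties as Vec
open import Data.Vec.Relation.Binary.Pointwise.Inductive as Vecᴾ using ([]; _∷_)
open import Data.Vec.Relation.Unary.All as Vecᴬ using ([]; _∷_)
open import Function.Base using (_∘_; id)
open import Function.Bundles using (Inverse)
import Function.Construct.Composition as Function
import Function.Construct.Symmetry as Symmetry
open import Relation.Binary.PropositionalEquality as ≡
  using (_≡_; _≢_; refl; cong; cong₂; subst; subst₂)
open import Relation.Nullary.Decidable using (Dec; yes; no; map′; ¬?; _×-dec_; _→-dec_; from-yes)
open import Relation.Nullary.Negation using (¬_; contradiction)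
open import Relation.Unary using (Decidable)

open AbelianGroup using (Carrier; rawGroup; rawMonoid; setoid)

infix 4 _[_≈_]

_[_≈_] : (G : Abelian) → Carrier G → Carrier G → Set
G [ x ≈ y ] = AbelianGroup._≈_ G x y

-- Homomorphisms and isomorphisms

IsHom : (G H : Abelian) → (Carrier G → Carrier H) → Set
IsHom G H = GroupMorphisms.IsGroupHomomorphism (rawGroup G) (rawGroup H)

module _ (G H : Abelian) where
  private
    module G = AbelianGroup G
    module H = AbelianGroup H
  open AbelianGroupProperties H using (identityʳ-unique; inverseʳ-unique)

  -- The image of `ε` is its own double, hence `ε`; then `f (x ⁻¹)` is an inverse of `f x`, and
  -- inverses are unique.
  mkHom : ∀ {f} → (∀ {x y} → x G.≈ y → f x H.≈ f y) →
          (∀ x y → f (x G.∙ y) H.≈ f x H.∙ f y) → IsHom G H f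
  mkHom {f} f-cong homo = record
    { isMonoidHomomorphism = record
      { isMagmaHomomorphism = record { isRelHomomorphism = record { cong = f-cong } ; homo = homo }
      ; ε-homo = ε-homo
      }
    ; ⁻¹-homo = λ x → inverseʳ-unique (f x) (f (x G.⁻¹))
        (H.trans (H.sym (homo _ _)) (H.trans (f-cong (G.inverseʳ x)) ε-homo))
    }
    where
    ε-homo : f G.ε H.≈ H.ε
    ε-homo = identityʳ-unique (f G.ε) (f G.ε)
      (H.trans (H.sym (homo _ _)) (f-cong (G.identityʳ G.ε)))

  mk≅ : ∀ {f} → IsHom G H f → (∀ {x y} → f x H.≈ f y → x G.≈ y) →
        (∀ y → ∃[ x ] f x H.≈ y) → G ≅ H
  mk≅ {f} hom injective surjective = f , record
    { isGroupMonomorphism = record { isGroupHomomorphism = hom ; injective = injective }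
    ; surjective = λ y → proj₁ (surjective y) ,
        λ z≈x → H.trans (⟦⟧-cong z≈x) (proj₂ (surjective y))
    }
    where open GroupMorphisms.IsGroupHomomorphism hom using (⟦⟧-cong)

module _ (G H : Abelian) where
  private
    module G = AbelianGroup G
    module H = AbelianGroup H

  inl-hom : IsHom G (G ⊕ H) (_, H.ε)
  inl-hom = mkHom G (G ⊕ H) (_, H.refl) (λ _ _ → G.refl , H.sym (H.identityˡ H.ε))

  inr-hom : IsHom H (G ⊕ H) (G.ε ,_)
  inr-hom = mkHom H (G ⊕ H) (G.refl ,_) (λ _ _ → G.sym (G.identityˡ G.ε) , H.refl)

  proj₁-hom : IsHom (G ⊕ H) G proj₁
  proj₁-hom = mkHom (G ⊕ H) G proj₁ (λ _ _ → G.refl)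

  proj₂-hom : IsHom (G ⊕ H) H proj₂
  proj₂-hom = mkHom (G ⊕ H) H proj₂ (λ _ _ → H.refl)

≅-refl : ∀ G → G ≅ G
≅-refl G = mk≅ G G (mkHom G G id (λ _ _ → G.refl)) id (λ y → y , G.refl)
  where module G = AbelianGroup G

≅-trans : ∀ G H K → G ≅ H → H ≅ K → G ≅ K
≅-trans G H K (f , f-iso) (g , g-iso) =
  g ∘ f , Compose.isGroupIsomorphism (AbelianGroup.trans K) f-iso g-iso

⊕-cong : ∀ G G′ H H′ → G ≅ G′ → H ≅ H′ → (G ⊕ H) ≅ (G′ ⊕ H′)
⊕-cong G G′ H H′ (f , f-iso) (g , g-iso) =
  mk≅ (G ⊕ H) (G′ ⊕ H′)
    (mkHom (G ⊕ H) (G′ ⊕ H′) {λ (x , y) → f x , g y}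
      (λ (p , q) → F.⟦⟧-cong p , K.⟦⟧-cong q)
      (λ (x , y) (x′ , y′) → F.∙-homo x x′ , K.∙-homo y y′))
    (λ (p , q) → F.injective p , K.injective q)
    (λ (x , y) → let (u , p) = F.surjective x ; (v , q) = K.surjective y in
      (u , v) , p (AbelianGroup.refl G) , q (AbelianGroup.refl H))
  where
  module F = GroupMorphisms.IsGroupIsomorphism f-iso
  module K = GroupMorphisms.IsGroupIsomorphism g-iso

⊕-identityˡ : ∀ G → (𝟘 ⊕ G) ≅ G
⊕-identityˡ G = mk≅ (𝟘 ⊕ G) G (proj₂-hom 𝟘 G) (_ ,_) (λ y → (_ , y) , AbelianGroup.refl G)

⊕-assoc : ∀ G H K → ((G ⊕ H) ⊕ K) ≅ (G ⊕ (H ⊕ K))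
⊕-assoc G H K = mk≅ ((G ⊕ H) ⊕ K) (G ⊕ (H ⊕ K))
  (mkHom ((G ⊕ H) ⊕ K) (G ⊕ (H ⊕ K)) {λ ((x , y) , z) → x , y , z}
    (λ ((p , q) , r) → p , q , r) (λ _ _ → G.refl , H.refl , K.refl))
  (λ (p , q , r) → (p , q) , r)
  (λ (x , y , z) → ((x , y) , z) , G.refl , H.refl , K.refl)
  where
  module G = AbelianGroup G
  module H = AbelianGroup H
  module K = AbelianGroup K

⊕-interchange : ∀ G H G′ H′ → ((G ⊕ H) ⊕ (G′ ⊕ H′)) ≅ ((G ⊕ G′) ⊕ (H ⊕ H′))
⊕-interchange G H G′ H′ = mk≅ ((G ⊕ H) ⊕ (G′ ⊕ H′)) ((G ⊕ G′) ⊕ (H ⊕ H′))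
  (mkHom ((G ⊕ H) ⊕ (G′ ⊕ H′)) ((G ⊕ G′) ⊕ (H ⊕ H′)) {λ ((x , y) , (x′ , y′)) → (x , x′) , (y , y′)}
    -- Equality in a direct sum is componentwise, so one rearrangement serves for congruence here
    -- and for injectivity below.
    swap (λ _ _ → (G.refl , G′.refl) , (H.refl , H′.refl)))
  swap
  (λ ((x , x′) , (y , y′)) → ((x , y) , (x′ , y′)) , (G.refl , G′.refl) , (H.refl , H′.refl))
  where
  module G = AbelianGroup G
  module H = AbelianGroup H
  module G′ = AbelianGroup G′
  module H′ = AbelianGroup H′

  swap : ∀ {A B A′ B′ : Set} → (A × B) × (A′ × B′) → (A × A′) × (B × B′)
  swap ((p , q) , (p′ , q′)) = (p , p′) , (q , q′)

^⊕-homo-+ : ∀ G k l → (G ^⊕ k ⊕ G ^⊕ l) ≅ (G ^⊕ (k + l))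
^⊕-homo-+ G zero l = ⊕-identityˡ (G ^⊕ l)
^⊕-homo-+ G (suc k) l =
  ≅-trans (G ^⊕ suc k ⊕ G ^⊕ l) (G ⊕ (G ^⊕ k ⊕ G ^⊕ l)) (G ^⊕ (suc k + l))
    (⊕-assoc G (G ^⊕ k) (G ^⊕ l)) (⊕-cong G G (G ^⊕ k ⊕ G ^⊕ l) (G ^⊕ (k + l)) (≅-refl G) (^⊕-homo-+ G k l))

⨁C-++ : ∀ ms ns → (⨁C ms ⊕ ⨁C ns) ≅ ⨁C (ms ++ ns)
⨁C-++ [] ns = ⊕-identityˡ (⨁C ns)
⨁C-++ (m ∷ ms) ns =
  ≅-trans (⨁C (m ∷ ms) ⊕ ⨁C ns) (C m ⊕ (⨁C ms ⊕ ⨁C ns)) (⨁C (m ∷ ms ++ ns))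
    (⊕-assoc (C m) (⨁C ms) (⨁C ns)) (⊕-cong (C m) (C m) (⨁C ms ⊕ ⨁C ns) (⨁C (ms ++ ns)) (≅-refl (C m)) (⨁C-++ ms ns))

C^⊕≅⨁C : ∀ n k → (C n ^⊕ k) ≅ ⨁C (replicate k n)
C^⊕≅⨁C n zero = ≅-refl 𝟘
C^⊕≅⨁C n (suc k) = 
  ⊕-cong (C n) (C n) (C n ^⊕ k) (⨁C (replicate k n)) (≅-refl (C n)) (C^⊕≅⨁C n k)

-- Zero-sum free sequences

HasZeroSumFree : Abelian → ℕ → Set
HasZeroSumFree G k = Σ[ xs ∈ List (Carrier G) ] length xs ≡ k × ZeroSumFree G xs

module _ {A : Set} where

  ++-⊆⁻ : ∀ {zs : List A} xs {ys} → zs ⊆ xs ++ ys →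
          ∃[ us ] ∃[ vs ] zs ≡ us ++ vs × us ⊆ xs × vs ⊆ ys
  ++-⊆⁻ [] p = [] , _ , refl , [] , p
  ++-⊆⁻ (x ∷ xs) (.x ∷ʳ p) =
    let us , vs , eq , q , r = ++-⊆⁻ xs p in us , vs , eq , x ∷ʳ q , r
  ++-⊆⁻ (x ∷ xs) (refl ∷ p) =
    let us , vs , eq , q , r = ++-⊆⁻ xs p in x ∷ us , vs , cong (x ∷_) eq , refl ∷ q , r

  map-⊆⁻ : ∀ {B : Set} (f : B → A) {ys} xs → ys ⊆ map f xs → ∃[ zs ] ys ≡ map f zs × zs ⊆ xs
  map-⊆⁻ f [] [] = [] , refl , []
  map-⊆⁻ f (x ∷ xs) (_ ∷ʳ p) = let zs , eq , q = map-⊆⁻ f xs p in zs , eq , x ∷ʳ q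
  map-⊆⁻ f (x ∷ xs) (refl ∷ p) =
    let zs , eq , q = map-⊆⁻ f xs p in x ∷ zs , cong (f x ∷_) eq , refl ∷ q

  replicate-⊆⁻ : ∀ n {x : A} {ys} → ys ⊆ replicate n x → ∃[ k ] ys ≡ replicate k x × k ≤ n
  replicate-⊆⁻ zero [] = 0 , refl , z≤n
  replicate-⊆⁻ (suc n) (_ ∷ʳ p) =
    let k , eq , k≤n = replicate-⊆⁻ n p in k , eq , ℕ.m≤n⇒m≤1+n k≤n
  replicate-⊆⁻ (suc n) (refl ∷ p) =
    let k , eq , k≤n = replicate-⊆⁻ n p in suc k , cong (_ ∷_) eq , s≤s k≤n

module _ (G : Abelian) where
  open AbelianGroup G using (_≈_; _∙_; ε; sym; trans; assoc; identityˡ; ∙-congˡ)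

  σ-++ : ∀ xs ys → σ G (xs ++ ys) ≈ σ G xs ∙ σ G ys
  σ-++ [] ys = sym (identityˡ (σ G ys))
  σ-++ (x ∷ xs) ys = trans (∙-congˡ (σ-++ xs ys)) (sym (assoc x (σ G xs) (σ G ys)))

  zeroSumFree⇒[] : ∀ {xs ys} → ZeroSumFree G xs → ys ⊆ xs → σ G ys ≈ ε → ys ≡ []
  zeroSumFree⇒[] {ys = []} _ _ _ = refl
  zeroSumFree⇒[] {ys = _ ∷ _} free p sum≈ε = contradiction sum≈ε (free p λ ())

module _ (G H : Abelian) {f} (hom : IsHom G H f) where
  private
    module G = AbelianGroup G
    module H = AbelianGroup H
  open GroupMorphisms.IsGroupHomomorphism hom

  σ-map : ∀ xs → σ H (map f xs) H.≈ f (σ G xs)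
  σ-map [] = H.sym ε-homo
  σ-map (x ∷ xs) = H.trans (H.∙-congˡ (σ-map xs)) (H.sym (homo x (σ G xs)))

-- A sublist of the image is the image of a sublist, and injectivity pulls a vanishing sum back
-- along `f`.
≅-zeroSumFree : ∀ G H → G ≅ H → ∀ {k} → HasZeroSumFree G k → HasZeroSumFree H k
≅-zeroSumFree G H (f , iso) (xs , len , free) =
  map f xs , ≡.trans (length-map f xs) len , λ {ys} → free′ {ys}
  where
  module H = AbelianGroup H
  open GroupMorphisms.IsGroupIsomorphism iso

  free′ : ZeroSumFree H (map f xs)
  free′ p ys≢[] sum≈ε with map-⊆⁻ f xs p
  ... | zs , refl , q = free q (ys≢[] ∘ cong (map f)) (injective
    (H.trans (H.trans (H.sym (σ-map G H isGroupHomomorphism zs)) sum≈ε) (H.sym ε-homo)))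

-- A sublist splits into terms from `G` and terms from `H`, whose sums are the two coordinates of
-- the total. If the total vanishes, both parts are empty.
⊕-zeroSumFree : ∀ G H {k l} → HasZeroSumFree G k → HasZeroSumFree H l →
                HasZeroSumFree (G ⊕ H) (k + l)
⊕-zeroSumFree G H (xs , refl , xs-free) (ys , refl , ys-free) =
  map inl xs ++ map inr ys ,
  ≡.trans (length-++ (map inl xs)) (cong₂ _+_ (length-map inl xs) (length-map inr ys)) ,
  λ {zs} → free {zs}
  where
  module G = AbelianGroup G
  module H = AbelianGroup H
  open AbelianGroup (G ⊕ H) using (_≈_; sym; trans; ∙-cong)

  inl : G.Carrier → Carrier (G ⊕ H)
  inl = _, H.ε

  inr : H.Carrier → Carrier (G ⊕ H)
  inr = G.ε ,_

  σ-inl-inr : ∀ us vs → σ (G ⊕ H) (map inl us ++ map inr vs) ≈ (σ G us , σ H vs)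
  σ-inl-inr us vs = trans (σ-++ (G ⊕ H) (map inl us) (map inr vs))
    (trans (∙-cong (σ-map G (G ⊕ H) (inl-hom G H) us) (σ-map H (G ⊕ H) (inr-hom G H) vs))
      (G.identityʳ (σ G us) , H.identityˡ (σ H vs)))

  free : ZeroSumFree (G ⊕ H) (map inl xs ++ map inr ys)
  free p zs≢[] sum≈ε with ++-⊆⁻ (map inl xs) p
  ... | _ , _ , refl , q , r with map-⊆⁻ inl xs q | map-⊆⁻ inr ys r
  ... | us , refl , q′ | vs , refl , r′ = zs≢[] (cong₂ (λ us vs → map inl us ++ map inr vs)
      (zeroSumFree⇒[] G xs-free q′ (proj₁ sums≈ε)) (zeroSumFree⇒[] H ys-free r′ (proj₂ sums≈ε)))
    where sums≈ε = trans (sym (σ-inl-inr us vs)) sum≈ε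

-- Sequences with prescribed multiplicities

expand : ∀ {A : Set} {n} → Vec ℕ n → Vec A n → List A
expand [] [] = []
expand (k ∷ ks) (x ∷ xs) = replicate k x ++ expand ks xs

length-expand : ∀ {A : Set} {n} (ks : Vec ℕ n) (xs : Vec A n) → length (expand ks xs) ≡ Vec.sum ks
length-expand [] [] = refl
length-expand (k ∷ ks) (x ∷ xs) = ≡.trans (length-++ (replicate k x))
  (cong₂ _+_ (length-replicate k) (length-expand ks xs))

-- Replaces quantification over sublists by quantification over the lattice points of a box.
expand-⊆⁻ : ∀ {A : Set} {n} (ns : Vec ℕ n) (xs : Vec A n) {ys} → ys ⊆ expand ns xs →
            ∃[ ks ] ys ≡ expand ks xs × Vecᴾ.Pointwise _≤_ ks ns
expand-⊆⁻ [] [] [] = [] , refl , []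
expand-⊆⁻ (n ∷ ns) (x ∷ xs) p with ++-⊆⁻ (replicate n x) p
... | _ , _ , refl , q , r with replicate-⊆⁻ n q | expand-⊆⁻ ns xs r
... | k , refl , k≤n | ks , refl , ks≤ns = k ∷ ks , refl , k≤n ∷ ks≤ns

dot : ∀ {n} → Vec ℕ n → Vec ℕ n → ℕ
dot [] [] = 0
dot (k ∷ ks) (c ∷ cs) = k * c + dot ks cs

dot-unit : ∀ k {n} (ks : Vec ℕ n) → dot (k ∷ ks) (1 ∷ Vec.replicate n 0) ≡ k
dot-unit k ks = ≡.trans (cong₂ _+_ (ℕ.*-identityʳ k) (dot-zeros ks)) (ℕ.+-identityʳ k)
  where
  dot-zeros : ∀ {n} (ks : Vec ℕ n) → dot ks (Vec.replicate n 0) ≡ 0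
  dot-zeros [] = refl
  dot-zeros (k ∷ ks) = cong₂ _+_ (ℕ.*-zeroʳ k) (dot-zeros ks)

dot-scale : ∀ m {n} (qs cs : Vec ℕ n) → dot (Vec.map (_* m) qs) cs ≡ dot qs cs * m
dot-scale m [] [] = refl
dot-scale m (q ∷ qs) (c ∷ cs) =
  ≡.trans (cong (λ d → q * m * c + d) (dot-scale m qs cs)) (distrib q m c (dot qs cs))
  where
  distrib : ∀ q m c d → q * m * c + d * m ≡ (q * c + d) * m
  distrib = solve-∀

module _ (G : Abelian) {n} {π : Carrier G → ℤ} (hom : IsHom G (C n) π) where
  private module Cₙ = AbelianGroup (C n)
  open GroupMorphisms.IsGroupHomomorphism hom

  σ-replicate-++ : ∀ k {x c ys d} → π x ≡ + c → π (σ G ys) Cₙ.≈ + d →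
                   π (σ G (replicate k x ++ ys)) Cₙ.≈ + (k * c + d)
  σ-replicate-++ zero _ ys-eq = ys-eq
  σ-replicate-++ (suc k) {x} {c} {ys} {d} x-eq ys-eq = Cₙ.trans (homo x _)
    (Cₙ.trans (Cₙ.∙-cong (Cₙ.reflexive x-eq) (σ-replicate-++ k {ys = ys} x-eq ys-eq))
      (Cₙ.reflexive (cong +_ (≡.sym (ℕ.+-assoc c (k * c) d)))))

  -- One coordinate `π` of the sum is a linear form in the multiplicities. The hypothesis equates
  -- integers rather than residues, so that for a concrete matrix it holds by `refl`.
  σ-expand : ∀ {l} ks (xs : Vec (Carrier G) l) cs → Vec.map π xs ≡ Vec.map +_ cs →
             π (σ G (expand ks xs)) Cₙ.≈ + dot ks cs
  σ-expand [] [] [] refl = ε-homo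
  σ-expand (k ∷ ks) (x ∷ xs) (c ∷ cs) eq with Vec.∷-injective eq
  ... | x-eq , xs-eq = σ-replicate-++ k {ys = expand ks xs} x-eq (σ-expand ks xs cs xs-eq)

  σ≈ε⇒∣dot : ∀ {l} ks (xs : Vec (Carrier G) l) cs → Vec.map π xs ≡ Vec.map +_ cs →
             G [ σ G (expand ks xs) ≈ AbelianGroup.ε G ] → n ∣ dot ks cs
  -- Congruence to 0 is divisibility of a difference from 0, whose absolute value computes to
  -- `dot ks cs + 0`.
  σ≈ε⇒∣dot ks xs cs eq sum≈ε = subst (n ∣_) (ℕ.+-identityʳ _) (∣⇒∣ᵤ (_≡_[mod_].difference
    (Cₙ.trans (Cₙ.sym (σ-expand ks xs cs eq)) (Cₙ.trans (⟦⟧-cong sum≈ε) ε-homo))))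

-- Unitriangular systems

-- The columns, below the diagonal, of a lower unitriangular matrix.
data Unitriangular : ℕ → Set where
  []  : Unitriangular 0
  _∷_ : ∀ {n} → Vec ℕ n → Unitriangular n → Unitriangular (suc n)

rows : ∀ {n} → Unitriangular n → Vec (Vec ℕ n) n
rows [] = []
rows {suc n} (c ∷ T) = (1 ∷ Vec.replicate n 0) ∷ Vec.zipWith _∷_ c (rows T)

module _ {m : ℕ} where

  ∣dot-∷⁻ : ∀ {k n l} (ks : Vec ℕ n) (c : Vec ℕ l) (rs : Vec (Vec ℕ n) l) → m ∣ k →
            Vecᴬ.All (λ r → m ∣ dot (k ∷ ks) r) (Vec.zipWith _∷_ c rs) →
            Vecᴬ.All (λ r → m ∣ dot ks r) rs
  ∣dot-∷⁻ ks [] [] m∣k [] = []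
  ∣dot-∷⁻ ks (c ∷ cs) (r ∷ rs) m∣k (p ∷ ps) =
    ℕᵈ.∣m+n∣m⇒∣n p (ℕᵈ.∣m⇒∣m*n c m∣k) ∷ ∣dot-∷⁻ ks cs rs m∣k ps

  -- Forward substitution: the first row is a unit vector and yields `m ∣ k`; deleting the first
  -- column then leaves a smaller system of the same kind.
  ∣rows⇒∣ : ∀ {n} (T : Unitriangular n) ks →
            Vecᴬ.All (λ r → m ∣ dot ks r) (rows T) → Vecᴬ.All (m ∣_) ks
  ∣rows⇒∣ [] [] [] = []
  ∣rows⇒∣ (c ∷ T) (k ∷ ks) (p ∷ ps) = m∣k ∷ ∣rows⇒∣ T ks (∣dot-∷⁻ ks c (rows T) m∣k ps)
    where m∣k = subst (m ∣_) (dot-unit k ks) p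

  ∣⇒multiples : ∀ {n} {ks : Vec ℕ n} → Vecᴬ.All (m ∣_) ks → ∃[ qs ] ks ≡ Vec.map (_* m) qs
  ∣⇒multiples [] = [] , refl
  ∣⇒multiples (ℕᵈ.divides q refl ∷ ps) with ∣⇒multiples ps
  ... | qs , refl = q ∷ qs , refl

-- The group C_m³ ⊕ C_{2m}⁴ ⊕ C_{6m}

-- `J m t` is `K m (3 * t) (4 * t) t` by definition. Independent exponents allow copies to be added
-- one at a time.
K : ℕ → ℕ → ℕ → ℕ → Abelian
K m a b c = C m ^⊕ a ⊕ C (2 * m) ^⊕ b ⊕ C (6 * m) ^⊕ c

-- The entries 1 stand for trivial summands of C_2⁴ ⊕ C_6; multiplied by m they become C_m³.
moduli : Vec ℕ 8
moduli = 1 ∷ 1 ∷ 1 ∷ 2 ∷ 2 ∷ 2 ∷ 2 ∷ 6 ∷ []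

-- Rows 4 to 8 hold the coordinates of the eight distinct terms in C_2⁴ ⊕ C_6. The first three rows
-- complete them to a square matrix of determinant 1.
triangle : Unitriangular 8
triangle
    = (0 ∷ 0 ∷ 1 ∷ 1 ∷ 1 ∷ 1 ∷ 4 ∷ [])
    ∷ (0 ∷ 1 ∷ 0 ∷ 1 ∷ 1 ∷ 4 ∷ [])
    ∷ (0 ∷ 1 ∷ 1 ∷ 1 ∷ 4 ∷ [])
    ∷ (0 ∷ 0 ∷ 0 ∷ 1 ∷ [])
    ∷ (0 ∷ 0 ∷ 1 ∷ [])
    ∷ (0 ∷ 2 ∷ [])
    ∷ (2 ∷ [])
    ∷ []
    ∷ []

matrix : Vec (Vec ℕ 8) 8
matrix = rows triangle

-- One more than the multiplicities: the sixth column occurs three times, every other column once.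
-- The entries sum to 18, whence the length 18m - 8.
bounds : Vec ℕ 8
bounds = 2 ∷ 2 ∷ 2 ∷ 2 ∷ 2 ∷ 4 ∷ 2 ∷ 2 ∷ []

-- Exhaustive search by nested bounded quantifiers; for `bounds` the box has 512 points.
box? : ∀ {n} (bs : Vec ℕ n) {P : Vec ℕ n → Set} → Decidable P →
       Dec (∀ qs → Vecᴾ.Pointwise _<_ qs bs → P qs)
box? [] P? = map′ (λ p → λ { [] [] → p }) (λ f → f [] []) (P? [])
box? (b ∷ bs) P? = map′
  (λ f → λ { (q ∷ qs) (q<b ∷ qs<bs) → f q<b qs qs<bs })
  (λ f {q} q<b qs qs<bs → f (q ∷ qs) (q<b ∷ qs<bs))
  (ℕ.allUpTo? (λ q → box? bs (P? ∘ (q ∷_))) b)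

-- The columns of the matrix, taken bounds − 1 times each, are the sequence of
-- length 10 over C_2⁴ ⊕ C_6, which was found by computer search.
matrix-zeroSumFree : ∀ qs → Vecᴾ.Pointwise _<_ qs bounds →
  Vecᴾ.Pointwise (λ d r → d ∣ dot qs r) moduli matrix → qs ≡ Vec.replicate 8 0
matrix-zeroSumFree = from-yes (box? bounds λ qs →
  Vecᴾ.decidable (λ d r → d ℕᵈ.∣? dot qs r) moduli matrix →-dec
  Vec.≡-dec ℕ._≟_ qs (Vec.replicate 8 0))

module _ (m : ℕ) .{{_ : NonZero m}} where

  multiplicities : ∀ {n} → Vec ℕ n → Vec ℕ n
  multiplicities = Vec.map (λ b → pred (b * m))

  -- From q m ≤ b m - 1 follows q m < b m, and `m` cancels. Nonzero bounds ensure that `pred` really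
  -- subtracts 1.
  multiples-bounded : ∀ {n} (qs bs : Vec ℕ n) → Vecᴬ.All NonZero bs →
    Vecᴾ.Pointwise _≤_ (Vec.map (_* m) qs) (multiplicities bs) → Vecᴾ.Pointwise _<_ qs bs
  multiples-bounded [] [] [] [] = []
  multiples-bounded (q ∷ qs) (b ∷ bs) (b≢0 ∷ bs≢0) (p ∷ ps) =
    ℕ.*-cancelʳ-< m q b (ℕ.≤-trans (s≤s p) (ℕ.≤-reflexive (ℕ.suc-pred (b * m) {{ℕ.m*n≢0 b m {{b≢0}}}})))
    ∷ multiples-bounded qs bs bs≢0 ps

  ∣-weaken : ∀ {n l} (ks : Vec ℕ n) (ds : Vec ℕ l) (rs : Vec (Vec ℕ n) l) →
    Vecᴾ.Pointwise (λ d r → d * m ∣ dot ks r) ds rs → Vecᴬ.All (λ r → m ∣ dot ks r) rs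
  ∣-weaken ks [] [] [] = []
  ∣-weaken ks (d ∷ ds) (r ∷ rs) (p ∷ ps) = ℕᵈ.∣-trans (ℕᵈ.n∣m*n d) p ∷ ∣-weaken ks ds rs ps

  -- The scaling step. Unimodularity gives `ks` the form m q; cancelling m from the divisibilities
  -- and from the bounds puts q into L and into the original box, so q is 0.
  dot-multiples-zero : ∀ ks → Vecᴾ.Pointwise _≤_ ks (multiplicities bounds) →
    Vecᴾ.Pointwise (λ d r → d * m ∣ dot ks r) moduli matrix → ks ≡ Vec.replicate 8 0
  dot-multiples-zero ks ks≤ ds∣
    with ∣⇒multiples (∣rows⇒∣ triangle ks (∣-weaken ks moduli matrix ds∣))
  ... | qs , refl = cong (Vec.map (_* m)) (matrix-zeroSumFree qs
    (multiples-bounded qs bounds (_ ∷ _ ∷ _ ∷ _ ∷ _ ∷ _ ∷ _ ∷ _ ∷ []) ks≤)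
    (Vecᴾ.map (λ {d} {r} p → ℕᵈ.*-cancelʳ-∣ m (subst (d * m ∣_) (dot-scale m qs r) p)) ds∣))

  open AbelianGroup (K m 3 4 1) using (_≈_; ε)

  element : Vec ℕ 8 → Carrier (K m 3 4 1)
  element (a₁ ∷ a₂ ∷ a₃ ∷ a₄ ∷ a₅ ∷ a₆ ∷ a₇ ∷ a₈ ∷ []) =
    (+ a₁ , + a₂ , + a₃ , _) , (+ a₄ , + a₅ , + a₆ , + a₇ , _) , (+ a₈ , _)

  -- The columns keep their integer entries; only the moduli by which they are read are multiplied
  -- by m.
  elements : Vec (Carrier (K m 3 4 1)) 8
  elements = Vec.map element (Vec.transpose matrix)

  σ≈ε⇒∣rows : ∀ ks → σ (K m 3 4 1) (expand ks elements) ≈ ε →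
              Vecᴾ.Pointwise (λ d r → d * m ∣ dot ks r) moduli matrix
  σ≈ε⇒∣rows ks sum≈ε =
      -- In each line the final `refl` checks by computation that this coordinate of `elements` is
      -- the given row of the matrix.
      coordinate 1 (λ ((a , _) , _) → a) (λ ((p , _) , _) → one p) (λ _ _ → C₁.refl) (row (# 0)) refl
    ∷ coordinate 1 (λ ((_ , a , _) , _) → a) (λ ((_ , p , _) , _) → one p) (λ _ _ → C₁.refl) (row (# 1)) refl
    ∷ coordinate 1 (λ ((_ , _ , a , _) , _) → a) (λ ((_ , _ , p , _) , _) → one p) (λ _ _ → C₁.refl) (row (# 2)) refl
    ∷ coordinate 2 (λ (_ , (a , _) , _) → a) (λ (_ , (p , _) , _) → p) (λ _ _ → C₂.refl) (row (# 3)) refl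
    ∷ coordinate 2 (λ (_ , (_ , a , _) , _) → a) (λ (_ , (_ , p , _) , _) → p) (λ _ _ → C₂.refl) (row (# 4)) refl
    ∷ coordinate 2 (λ (_ , (_ , _ , a , _) , _) → a) (λ (_ , (_ , _ , p , _) , _) → p) (λ _ _ → C₂.refl) (row (# 5)) refl
    ∷ coordinate 2 (λ (_ , (_ , _ , _ , a , _) , _) → a) (λ (_ , (_ , _ , _ , p , _) , _) → p) (λ _ _ → C₂.refl) (row (# 6)) refl
    ∷ coordinate 6 (λ (_ , _ , a , _) → a) (λ (_ , _ , p , _) → p) (λ _ _ → C₆.refl) (row (# 7)) refl
    ∷ []
    where
    row = Vec.lookup matrix

    module C₁ = AbelianGroup (C (1 * m))
    module C₂ = AbelianGroup (C (2 * m))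
    module C₆ = AbelianGroup (C (6 * m))

    -- The first three summands are `C m`, whereas their moduli give `1 * m`, which does not reduce
    -- to `m`.
    one : ∀ {x y} → x ≡ y [mod m ] → x ≡ y [mod 1 * m ]
    one {x} {y} = subst (x ≡ y [mod_]) (≡.sym (ℕ.*-identityˡ m))

    coordinate : ∀ d (π : Carrier (K m 3 4 1) → ℤ) →
      (∀ {x y} → x ≈ y → π x ≡ π y [mod d * m ]) →
      (∀ x y → π (AbelianGroup._∙_ (K m 3 4 1) x y) ≡ π x ℤ.+ π y [mod d * m ]) →
      ∀ r → Vec.map π elements ≡ Vec.map +_ r → d * m ∣ dot ks r
    coordinate d π π-cong homo r eq =
      σ≈ε⇒∣dot (K m 3 4 1) (mkHom (K m 3 4 1) (C (d * m)) {π} π-cong homo) ks elements r eq sum≈ε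

  K-zeroSumFree : HasZeroSumFree (K m 3 4 1) (Vec.sum (multiplicities bounds))
  K-zeroSumFree = expand ns elements , length-expand ns elements , λ {ys} → free {ys}
    where
    ns = multiplicities bounds

    free : ZeroSumFree (K m 3 4 1) (expand ns elements)
    free p ys≢[] sum≈ε =
      let ks , ys≡ , ks≤ns = expand-⊆⁻ ns elements p
          ks≡0 = dot-multiples-zero ks ks≤ns
                   (σ≈ε⇒∣rows ks (subst (λ ys → σ (K m 3 4 1) ys ≈ ε) ys≡ sum≈ε))
      in ys≢[] (≡.trans ys≡ (cong (λ ks → expand ks elements) ks≡0))

-- Finiteness and the existence of the Davenport constant

-- Searches downwards from the bound; `P 0` guarantees a hit.
greatest : ∀ {P : ℕ → Set} → Decidable P → P 0 → ∀ b → (∀ k → P k → k ≤ b) → ∃ (IsGreatest P)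
greatest P? P0 zero bound = 0 , P0 , bound
greatest P? P0 (suc b) bound with P? (suc b)
... | yes Pb = suc b , Pb , bound
... | no ¬Pb = greatest P? P0 b λ k Pk →
  ℕ.≤-pred (ℕ.≤∧≢⇒< (bound k Pk) (λ { refl → ¬Pb Pk }))

-- Such a bijection supplies both decidable equality, used for the existence of d, and the exact
-- order, used for the rank.
Enumeration : ℕ → Abelian → Set
Enumeration N G = Inverse (≡.setoid (Fin N)) (setoid G)

𝟘-enumeration : Enumeration 1 𝟘
𝟘-enumeration = record
  { to = _ ; from = λ _ → Fin.zero ; to-cong = _ ; from-cong = λ _ → refl
  ; inverse = _ , λ { {Fin.zero} _ → refl } }

⊕-enumeration : ∀ {M N} G H → Enumeration M G → Enumeration N H → Enumeration (M * N) (G ⊕ H)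
⊕-enumeration G H e f =
  Function.inverse Fin.*↔× (Function.inverse (Symmetry.inverse Pointwise-≡↔≡) (e ×-inverse f))

^⊕-enumeration : ∀ {N} G → Enumeration N G → ∀ k → Enumeration (N ^ k) (G ^⊕ k)
^⊕-enumeration G e zero = 𝟘-enumeration
^⊕-enumeration G e (suc k) = ⊕-enumeration G (G ^⊕ k) e (^⊕-enumeration G e k)

C-enumeration : ∀ n .{{_ : NonZero n}} → Enumeration n (C n)
C-enumeration n = record
  { to = rep
  ; from = residue
  ; to-cong = λ { refl → Cₙ.refl }
  ; from-cong = residue-cong
  ; inverse = (λ { refl → rep-residue _ })
            , λ {i} x≈i → rep-injective (Cₙ.trans (rep-residue _) x≈i)
  }
  where
  module Cₙ = AbelianGroup (C n)

  rep : Fin n → ℤ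
  rep i = + toℕ i

  residue : ℤ → Fin n
  residue x = fromℕ< (n%ℕd<d x n)

  rep-residue : ∀ x → rep (residue x) Cₙ.≈ x
  rep-residue x = congruent (divides (ℤ.- (x /ℕ n)) (begin
    rep (residue x) ℤ.- x
      ≡⟨ cong (λ r → + r ℤ.- x) (Fin.toℕ-fromℕ< (n%ℕd<d x n)) ⟩
    + (x %ℕ n) ℤ.- x
      ≡⟨ cong (λ y → + (x %ℕ n) ℤ.- y) (a≡a%ℕn+[a/ℕn]*n x n) ⟩
    + (x %ℕ n) ℤ.- (+ (x %ℕ n) ℤ.+ (x /ℕ n) ℤ.* + n)
      ≡⟨ cancel (+ (x %ℕ n)) (x /ℕ n) (+ n) ⟩
    ℤ.- (x /ℕ n) ℤ.* + n ∎))
    where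
    open ≡.≡-Reasoning
    cancel : ∀ r q n → r ℤ.- (r ℤ.+ q ℤ.* n) ≡ ℤ.- q ℤ.* n
    cancel = ℤ-Solver.solve-∀

  ∣∧<⇒≡0 : ∀ {k} → n ∣ k → k < n → k ≡ 0
  ∣∧<⇒≡0 {zero} _ _ = refl
  ∣∧<⇒≡0 {suc k} n∣k k<n = contradiction n∣k (ℕᵈ.>⇒∤ k<n)

  -- The difference is below `n` and divisible by `n`, hence 0. The assumption `b ≤ a` makes
  -- truncated subtraction agree with that of ℤ.
  <-congruent : ∀ {a b} → b ≤ a → a < n → + a Cₙ.≈ + b → a ≡ b
  <-congruent {a} {b} b≤a a<n (congruent d) = ℕ.≤-antisym (ℕ.m∸n≡0⇒m≤n a∸b≡0) b≤a
    where
    n∣a∸b : n ∣ a ℕ.∸ b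
    n∣a∸b = ∣⇒∣ᵤ (subst (+ n ℤᵈ.∣_) (≡.trans (ℤ.m-n≡m⊖n a b) (ℤ.⊖-≥ b≤a)) d)
    a∸b≡0 : a ℕ.∸ b ≡ 0
    a∸b≡0 = ∣∧<⇒≡0 n∣a∸b (ℕ.≤-<-trans (ℕ.m∸n≤m a b) a<n)

  rep-injective : ∀ {i j} → rep i Cₙ.≈ rep j → i ≡ j
  rep-injective {i} {j} i≈j with ℕ.≤-total (toℕ i) (toℕ j)
  ... | inj₁ i≤j = Fin.toℕ-injective (≡.sym (<-congruent i≤j (Fin.toℕ<n j) (Cₙ.sym i≈j)))
  ... | inj₂ j≤i = Fin.toℕ-injective (<-congruent j≤i (Fin.toℕ<n i) i≈j)

  residue-cong : ∀ {x y} → x Cₙ.≈ y → residue x ≡ residue y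
  residue-cong x≈y = rep-injective
    (Cₙ.trans (rep-residue _) (Cₙ.trans x≈y (Cₙ.sym (rep-residue _))))

-- Decidability of zero-sum freeness and the length bound

all⊆? : ∀ {A : Set} {P : List A → Set} → Decidable P → ∀ xs → Dec (∀ {ys} → ys ⊆ xs → P ys)
all⊆? P? [] = map′ (λ { p [] → p }) (λ f → f []) (P? [])
all⊆? {P = P} P? (x ∷ xs) = map′ join (λ f → (λ {ys} p → f (x ∷ʳ p)) , (λ {ys} p → f (refl ∷ p)))
  (all⊆? P? xs ×-dec all⊆? (P? ∘ (x ∷_)) xs)
  where
  join : (∀ {ys} → ys ⊆ xs → P ys) × (∀ {ys} → ys ⊆ xs → P (x ∷ ys)) → ∀ {ys} → ys ⊆ x ∷ xs → P ys
  join (f , g) (_ ∷ʳ p) = f p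
  join (f , g) (refl ∷ p) = g p

Pointwise-⊆ : ∀ {A : Set} {R : A → A → Set} {xs xs′ ys} → Pointwise R xs xs′ → ys ⊆ xs′ →
              ∃[ ys′ ] ys′ ⊆ xs × Pointwise R ys′ ys
Pointwise-⊆ [] [] = [] , [] , []
Pointwise-⊆ (r ∷ rs) (_ ∷ʳ p) = let ys′ , q , ss = Pointwise-⊆ rs p in ys′ , _ ∷ʳ q , ss
Pointwise-⊆ (r ∷ rs) (refl ∷ p) = let ys′ , q , ss = Pointwise-⊆ rs p in _ ∷ ys′ , refl ∷ q , r ∷ ss

module _ (G : Abelian) {N : ℕ} (enum : Enumeration N G) where
  open AbelianGroup G using (_≈_; _∙_; ε; sym; trans; assoc; identityˡ; ∙-cong; ∙-congˡ)
  open AbelianGroupProperties G using (identityʳ-unique)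
  open Inverse enum using (to; from; from-cong; to-cong; strictlyInverseˡ)

  from-injective : ∀ {x y} → from x ≡ from y → x ≈ y
  from-injective eq = trans (sym (strictlyInverseˡ _)) (trans (to-cong eq) (strictlyInverseˡ _))

  ≈-dec : ∀ x y → Dec (x ≈ y)
  ≈-dec x y = map′ from-injective from-cong (from x Fin.≟ from y)

  σ-cong : ∀ {xs ys} → Pointwise _≈_ xs ys → σ G xs ≈ σ G ys
  σ-cong [] = AbelianGroup.refl G
  σ-cong (r ∷ rs) = ∙-cong r (σ-cong rs)

  zeroSumFree-resp : ∀ {xs xs′} → Pointwise _≈_ xs xs′ → ZeroSumFree G xs → ZeroSumFree G xs′
  zeroSumFree-resp rs free p ys≢[] sum≈ε with Pointwise-⊆ rs p
  ... | _ , q , [] = ys≢[] refl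
  ... | _ , q , ss@(_ ∷ _) = free q (λ ()) (trans (σ-cong ss) sum≈ε)

  zeroSumFree? : Decidable (ZeroSumFree G)
  zeroSumFree? = all⊆? λ ys → ¬? (null? ys) →-dec ¬? (≈-dec (σ G ys) ε)
    where
    null? : ∀ ys → Dec (ys ≡ [])
    null? [] = yes refl
    null? (_ ∷ _) = no λ ()

  -- The carrier may be infinite as a type, so only lists of representatives `to i` are searched;
  -- `resp` moves any other list onto representatives.
  ∃-list? : ∀ {P : List (Carrier G) → Set} → Decidable P →
            (∀ {xs ys} → Pointwise _≈_ xs ys → P xs → P ys) →
            ∀ k → Dec (Σ[ xs ∈ List (Carrier G) ] length xs ≡ k × P xs)
  ∃-list? P? resp zero = map′ (λ p → [] , refl , p) (λ { ([] , _ , p) → p }) (P? [])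
  ∃-list? P? resp (suc k) = map′
    (λ (i , xs , len , p) → to i ∷ xs , cong suc len , p)
    (λ { (x ∷ xs , refl , p) → from x , xs , refl ,
         resp (sym (strictlyInverseˡ x) ∷ Pointwise.refl (AbelianGroup.refl G)) p })
    (Fin.any? λ i → ∃-list? (P? ∘ (to i ∷_)) (resp ∘ (AbelianGroup.refl G ∷_)) k)

  σ-segment : ∀ {i j} → i < j → ∀ xs → j ≤ length xs →
    ∃[ ys ] ys ⊆ xs × ys ≢ [] × σ G (take j xs) ≈ σ G (take i xs) ∙ σ G ys
  σ-segment {zero} {suc j} _ (x ∷ xs) _ =
    take (suc j) (x ∷ xs) , take-⊆ (suc j) (x ∷ xs) , (λ ()) , sym (identityˡ _)
  σ-segment {suc i} {suc j} (s≤s i<j) (x ∷ xs) (s≤s j≤) =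
    let ys , p , ys≢[] , eq = σ-segment i<j xs j≤
    in ys , x ∷ʳ p , ys≢[] , trans (∙-congˡ eq) (sym (assoc x _ _))

  zeroSumFree-bounded : ∀ xs → ZeroSumFree G xs → length xs ≤ N
  zeroSumFree-bounded xs free = ℕ.≮⇒≥ λ N<length →
    -- The prefixes of lengths 0 to `length xs` - 1 already outnumber the `N` elements. The segment
    -- between two prefixes of equal sum has sum zero.
    let i , j , i<j , eq = Fin.pigeonhole N<length (λ i → from (σ G (take (toℕ i) xs)))
        ys , p , ys≢[] , sums = σ-segment i<j xs (ℕ.<⇒≤ (Fin.toℕ<n j))
    in free p ys≢[] (identityʳ-unique _ _ (trans (sym sums) (sym (from-injective eq))))

  d-exists : ∃ (Is-d G)
  d-exists = greatest
    (∃-list? zeroSumFree? (λ rs free {ys} → zeroSumFree-resp rs (λ {zs} → free {zs}) {ys}))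
    ([] , refl , λ { [] ys≢[] _ → ys≢[] refl }) N
    λ { _ (xs , refl , free) → zeroSumFree-bounded xs free }

-- Generators and the rank

_·⟨_⟩_ : ℕ → (G : Abelian) → Carrier G → Carrier G
n ·⟨ G ⟩ x = RawMonoidDefs._×_ (rawMonoid G) n x

module _ (G H : Abelian) {f} (hom : IsHom G H f) where
  private
    module G = AbelianGroup G
    module H = AbelianGroup H
  open GroupMorphisms.IsGroupHomomorphism hom

  hom-· : ∀ n x → f (n ·⟨ G ⟩ x) H.≈ n ·⟨ H ⟩ f x
  hom-· zero x = ε-homo
  hom-· (suc n) x = H.trans (homo x _) (H.∙-congˡ (hom-· n x))

  hom-⟨⟩ : ∀ {gs x} → ⟨_⟩ G gs x → ⟨_⟩ H (map f gs) (f x)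
  hom-⟨⟩ (generator x∈gs) = generator (∈-map⁺ G.setoid H.setoid ⟦⟧-cong x∈gs)
  hom-⟨⟩ identity∈ = resp∈ (H.sym ε-homo) identity∈
  hom-⟨⟩ (product∈ p q) = resp∈ (H.sym (homo _ _)) (product∈ (hom-⟨⟩ p) (hom-⟨⟩ q))
  hom-⟨⟩ (inverse∈ p) = resp∈ (H.sym (⁻¹-homo _)) (inverse∈ (hom-⟨⟩ p))
  hom-⟨⟩ (resp∈ x≈y p) = resp∈ (⟦⟧-cong x≈y) (hom-⟨⟩ p)

⟨⟩-mono : ∀ G {gs hs : List (Carrier G)} →
  (∀ {x} → SetoidMembership._∈_ (setoid G) x gs → SetoidMembership._∈_ (setoid G) x hs) →
  ∀ {x} → ⟨_⟩ G gs x → ⟨_⟩ G hs x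
⟨⟩-mono G gs⊆hs (generator x∈gs) = generator (gs⊆hs x∈gs)
⟨⟩-mono G gs⊆hs identity∈ = identity∈
⟨⟩-mono G gs⊆hs (product∈ p q) = product∈ (⟨⟩-mono G gs⊆hs p) (⟨⟩-mono G gs⊆hs q)
⟨⟩-mono G gs⊆hs (inverse∈ p) = inverse∈ (⟨⟩-mono G gs⊆hs p)
⟨⟩-mono G gs⊆hs (resp∈ x≈y p) = resp∈ x≈y (⟨⟩-mono G gs⊆hs p)

Generated : Abelian → ℕ → Set
Generated G k = Σ[ gs ∈ List (Carrier G) ] length gs ≡ k × (∀ x → ⟨_⟩ G gs x)

C-generated : ∀ n → Generated (C n) 1
C-generated n = + 1 ∷ [] , refl , λ { (+ k) → ℕ-generated k ; -[1+ k ] → inverse∈ (ℕ-generated (suc k)) }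
  where
  ℕ-generated : ∀ k → ⟨_⟩ (C n) (+ 1 ∷ []) (+ k)
  ℕ-generated zero = identity∈
  ℕ-generated (suc k) = product∈ (generator (here (AbelianGroup.refl (C n)))) (ℕ-generated k)

⊕-generated : ∀ G H {k l} → Generated G k → Generated H l → Generated (G ⊕ H) (k + l)
⊕-generated G H (gs , refl , G-gen) (hs , refl , H-gen) =
  map (_, H.ε) gs ++ map (G.ε ,_) hs ,
  ≡.trans (length-++ (map (_, H.ε) gs)) (cong₂ _+_ (length-map _ gs) (length-map _ hs)) ,
  λ (x , y) → resp∈ (G.identityʳ x , H.identityˡ y) (product∈
    (⟨⟩-mono (G ⊕ H) (∈-++⁺ˡ (setoid (G ⊕ H))) (hom-⟨⟩ G (G ⊕ H) (inl-hom G H) (G-gen x)))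
    (⟨⟩-mono (G ⊕ H) (∈-++⁺ʳ (setoid (G ⊕ H)) (map (_, H.ε) gs))
      (hom-⟨⟩ H (G ⊕ H) (inr-hom G H) (H-gen y))))
  where
  module G = AbelianGroup G
  module H = AbelianGroup H

^⊕-generated : ∀ G → Generated G 1 → ∀ k → Generated (G ^⊕ k) k
^⊕-generated G gen zero = [] , refl , λ _ → identity∈
^⊕-generated G gen (suc k) = ⊕-generated G (G ^⊕ k) gen (^⊕-generated G gen k)

-- Integers annihilating a group

Kills : ℕ → Abelian → Set
Kills e G = ∀ x → G [ e ·⟨ G ⟩ x ≈ AbelianGroup.ε G ]

⊕-kills : ∀ e G H → Kills e G → Kills e H → Kills e (G ⊕ H)
⊕-kills e G H G-kills H-kills (x , y) =
  AbelianGroup.trans G (hom-· (G ⊕ H) G (proj₁-hom G H) e (x , y)) (G-kills x) ,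
  AbelianGroup.trans H (hom-· (G ⊕ H) H (proj₂-hom G H) e (x , y)) (H-kills y)

^⊕-kills : ∀ e G → Kills e G → ∀ k → Kills e (G ^⊕ k)
^⊕-kills e G kills zero _ = _
^⊕-kills e G kills (suc k) = ⊕-kills e G (G ^⊕ k) kills (^⊕-kills e G kills k)

⊕-kills⁻ˡ : ∀ e G H → Kills e (G ⊕ H) → Kills e G
⊕-kills⁻ˡ e G H kills x =
  AbelianGroup.trans G (AbelianGroup.sym G (hom-· (G ⊕ H) G (proj₁-hom G H) e _))
    (proj₁ (kills (x , AbelianGroup.ε H)))

⊕-kills⁻ʳ : ∀ e G H → Kills e (G ⊕ H) → Kills e H
⊕-kills⁻ʳ e G H kills y =
  AbelianGroup.trans H (AbelianGroup.sym H (hom-· (G ⊕ H) H (proj₂-hom G H) e _))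
    (proj₂ (kills (AbelianGroup.ε G , y)))

·-ℤ : ∀ n k x → k ·⟨ C n ⟩ x ≡ + k ℤ.* x
·-ℤ n zero x = ≡.sym (ℤ.*-zeroˡ x)
·-ℤ n (suc k) x = ≡.trans (cong (λ y → x ℤ.+ y) (·-ℤ n k x)) (≡.sym (ℤ.suc-* (+ k) x))

∣⇒C-kills : ∀ {n e} → n ∣ e → Kills e (C n)
∣⇒C-kills {n} {e} n∣e x = congruent (subst (+ n ℤᵈ.∣_)
  (≡.trans (≡.sym (·-ℤ n e x)) (≡.sym (ℤ.+-identityʳ _)))
  (ℤᵈ.∣m⇒∣m*n {m = + e} x (∣ᵤ⇒∣ n∣e)))

-- Annihilation is evaluated at the generator 1.
C-kills⇒∣ : ∀ {n e} → Kills e (C n) → n ∣ e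
C-kills⇒∣ {n} {e} kills = ∣⇒∣ᵤ (subst (+ n ℤᵈ.∣_)
  (≡.trans (ℤ.+-identityʳ _) (≡.trans (·-ℤ n e (+ 1)) (ℤ.*-identityʳ (+ e))))
  (_≡_[mod_].difference (kills (+ 1))))

-- Counting the elements generated in a group killed by m

module _ (G : Abelian) (m : ℕ) .{{_ : NonZero m}} (kills : Kills m G) where
  open AbelianGroup G hiding (Carrier; rawGroup; rawMonoid; setoid; _-_; refl)
  open AbelianGroupProperties G using (⁻¹-∙-comm; inverseʳ-unique)
  open CommutativeSemigroupProperties commutativeSemigroup using (interchange)
  open Mult monoid renaming (_×_ to _·_)

  -- Adding `n · x` gives `m · (n · x)`, which vanishes. Inverses thus become natural multiples, and
  -- coefficients can stay in ℕ.
  ·-inverse : ∀ n x → (n · x) ⁻¹ ≈ (pred m * n) · x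
  ·-inverse n x = sym (inverseʳ-unique _ _ (trans (sym (×-homo-+ x n (pred m * n)))
    (trans (×-congˡ (cong (_* n) (ℕ.suc-pred m))) (trans (sym (×-assocˡ x m n)) (kills (n · x))))))

  ·-% : ∀ n x → n · x ≈ (n ℕ.% m) · x
  ·-% n x = trans (×-congˡ n≡) (trans (×-homo-+ x (n ℕ.% m) (m * (n ℕ./ m)))
    (trans (∙-congˡ (trans (sym (×-assocˡ x m (n ℕ./ m))) (kills _))) (identityʳ _)))
    where
    n≡ : n ≡ n ℕ.% m + m * (n ℕ./ m)
    n≡ = ≡.trans (ℕ.m≡m%n+[m/n]*n n m) (cong (λ y → n ℕ.% m + y) (ℕ.*-comm (n ℕ./ m) m))

  ⟨∷⟩-split : ∀ {g gs x} → ⟨_⟩ G (g ∷ gs) x → ∃[ n ] ∃[ y ] ⟨_⟩ G gs y × x ≈ n · g ∙ y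
  ⟨∷⟩-split (generator (here x≈g)) =
    1 , ε , identity∈ , trans x≈g (sym (trans (identityʳ _) (identityʳ _)))
  ⟨∷⟩-split (generator (there x∈gs)) = 0 , _ , generator x∈gs , sym (identityˡ _)
  ⟨∷⟩-split identity∈ = 0 , ε , identity∈ , sym (identityˡ ε)
  ⟨∷⟩-split {g} (product∈ p q) =
    let n , y , y∈ , x≈ = ⟨∷⟩-split p
        n′ , y′ , y′∈ , x′≈ = ⟨∷⟩-split q
    in n + n′ , y ∙ y′ , product∈ y∈ y′∈ ,
       trans (∙-cong x≈ x′≈) (trans (interchange _ _ _ _) (∙-congʳ (sym (×-homo-+ g n n′))))
  ⟨∷⟩-split {g} (inverse∈ p) =
    let n , y , y∈ , x≈ = ⟨∷⟩-split p
    in pred m * n , y ⁻¹ , inverse∈ y∈ ,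
       trans (⁻¹-cong x≈) (trans (sym (⁻¹-∙-comm _ _)) (∙-congʳ (·-inverse n g)))
  ⟨∷⟩-split (resp∈ x≈x′ p) =
    let n , y , y∈ , x≈ = ⟨∷⟩-split p in n , y , y∈ , trans (sym x≈x′) x≈

  ⟨[]⟩-trivial : ∀ {x} → ⟨_⟩ G [] x → x ≈ ε
  ⟨[]⟩-trivial identity∈ = AbelianGroup.refl G
  ⟨[]⟩-trivial (product∈ p q) = trans (∙-cong (⟨[]⟩-trivial p) (⟨[]⟩-trivial q)) (identityʳ ε)
  ⟨[]⟩-trivial (inverse∈ p) =
    trans (⁻¹-cong (⟨[]⟩-trivial p)) (trans (sym (identityˡ _)) (inverseʳ ε))
  ⟨[]⟩-trivial (resp∈ x≈y p) = trans (sym x≈y) (⟨[]⟩-trivial p)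

  -- A code below `m ^ length gs` is read in base m, its digits being the coefficients of the
  -- generators.
  combination : ∀ gs → Fin (m ^ length gs) → Carrier G
  combination [] _ = ε
  combination (g ∷ gs) c =
    let i , c′ = remQuot {m} (m ^ length gs) c in toℕ i · g ∙ combination gs c′

  combination-surjective : ∀ gs {x} → ⟨_⟩ G gs x → ∃[ c ] combination gs c ≈ x
  combination-surjective [] p = Fin.zero , sym (⟨[]⟩-trivial p)
  combination-surjective (g ∷ gs) {x} p =
    let n , y , y∈ , x≈ = ⟨∷⟩-split p
        c , c≈y = combination-surjective gs y∈
        i = fromℕ< (ℕ.m%n<n n m)
    in combine i c , (begin
      combination (g ∷ gs) (combine i c)
        ≡⟨ cong (λ (i , c) → toℕ i · g ∙ combination gs c) (Fin.remQuot-combine i c) ⟩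
      toℕ i · g ∙ combination gs c
        ≈⟨ ∙-cong (×-congˡ (Fin.toℕ-fromℕ< (ℕ.m%n<n n m))) c≈y ⟩
      (n ℕ.% m) · g ∙ y
        ≈⟨ ∙-congʳ (·-% n g) ⟨
      n · g ∙ y
        ≈⟨ x≈ ⟨
      x ∎)
    where open import Relation.Binary.Reasoning.Setoid (AbelianGroup.setoid G)

  -- Choosing a code for each element defines an injection from `Fin N` to `Fin (m ^ k)`, since the
  -- code determines the element.
  generated-bound : ∀ {N k} → Enumeration N G → Generated G k → N ≤ m ^ k
  generated-bound enum (gs , refl , gen) =
    Fin.injective⇒≤ {f = λ i → proj₁ (code i)} λ {i} {j} eq →
      ≡.trans (≡.sym (strictlyInverseʳ i)) (≡.trans (from-cong
        (trans (sym (proj₂ (code i)))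
          (trans (reflexive (cong (combination gs) eq)) (proj₂ (code j)))))
        (strictlyInverseʳ j))
    where
    open Inverse enum using (to; from-cong; strictlyInverseʳ)
    code : ∀ i → ∃[ c ] combination gs c ≈ to i
    code i = combination-surjective gs (gen (to i))

-- Quotients

_↠_ : Abelian → Abelian → Set
G ↠ H = ∃[ f ] IsHom G H f × (∀ y → ∃[ x ] H [ f x ≈ y ])

⊕-↠ : ∀ G G′ H H′ → G ↠ G′ → H ↠ H′ → (G ⊕ H) ↠ (G′ ⊕ H′)
⊕-↠ G G′ H H′ (f , f-hom , f-surj) (g , g-hom , g-surj) =
  _ ,
  mkHom (G ⊕ H) (G′ ⊕ H′) {λ (x , y) → f x , g y}
    (λ (p , q) → F.⟦⟧-cong p , K.⟦⟧-cong q)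
    (λ (x , y) (x′ , y′) → F.homo x x′ , K.homo y y′) ,
  λ (x , y) → let (u , p) = f-surj x ; (v , q) = g-surj y in (u , v) , p , q
  where
  module F = GroupMorphisms.IsGroupHomomorphism f-hom
  module K = GroupMorphisms.IsGroupHomomorphism g-hom

^⊕-↠ : ∀ G H → G ↠ H → ∀ k → (G ^⊕ k) ↠ (H ^⊕ k)
^⊕-↠ G H f zero = id , mkHom 𝟘 𝟘 {id} _ _ , λ _ → _
^⊕-↠ G H f (suc k) = ⊕-↠ G H (G ^⊕ k) (H ^⊕ k) f (^⊕-↠ G H f k)

-- Both carriers are ℤ, and congruence modulo `n` refines congruence modulo `d`, so the identity map
-- descends.
C-↠ : ∀ {n d} → d ∣ n → C n ↠ C d
C-↠ {n} {d} d∣n = id ,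
  mkHom (C n) (C d) {id} (λ (congruent p) → congruent (ℤᵈ.∣-trans (∣ᵤ⇒∣ d∣n) p)) (λ _ _ → Cd.refl) ,
  λ y → y , Cd.refl
  where module Cd = AbelianGroup (C d)

↠-generated : ∀ G H {k} → G ↠ H → Generated G k → Generated H k
↠-generated G H (f , hom , surj) (gs , len , gen) =
  map f gs , ≡.trans (length-map f gs) len ,
  λ y → let x , fx≈y = surj y in resp∈ fx≈y (hom-⟨⟩ G H hom (gen x))

-- The groups J m t

-- Two interchanges bring powers of the same cyclic group together, where they merge by adding
-- exponents.
K-zeroSumFree-+ : ∀ m a b c a′ b′ c′ {k l} →
  HasZeroSumFree (K m a b c) k → HasZeroSumFree (K m a′ b′ c′) l →
  HasZeroSumFree (K m (a + a′) (b + b′) (c + c′)) (k + l)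
K-zeroSumFree-+ m a b c a′ b′ c′ p q =
  ≅-zeroSumFree (K m a b c ⊕ K m a′ b′ c′) (K m (a + a′) (b + b′) (c + c′))
    (≅-trans (K m a b c ⊕ K m a′ b′ c′) (A a a′ ⊕ (B b ⊕ D c) ⊕ (B b′ ⊕ D c′))
             (K m (a + a′) (b + b′) (c + c′))
      (⊕-interchange (C m ^⊕ a) (B b ⊕ D c) (C m ^⊕ a′) (B b′ ⊕ D c′))
      (⊕-cong (A a a′) (C m ^⊕ (a + a′)) ((B b ⊕ D c) ⊕ (B b′ ⊕ D c′)) (B (b + b′) ⊕ D (c + c′))
        (^⊕-homo-+ (C m) a a′)
        (≅-trans ((B b ⊕ D c) ⊕ (B b′ ⊕ D c′)) ((B b ⊕ B b′) ⊕ (D c ⊕ D c′)) (B (b + b′) ⊕ D (c + c′))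
          (⊕-interchange (B b) (D c) (B b′) (D c′))
          (⊕-cong (B b ⊕ B b′) (B (b + b′)) (D c ⊕ D c′) (D (c + c′))
            (^⊕-homo-+ (C (2 * m)) b b′) (^⊕-homo-+ (C (6 * m)) c c′)))))
    (⊕-zeroSumFree (K m a b c) (K m a′ b′ c′) p q)
  where
  A : ℕ → ℕ → Abelian
  A a a′ = C m ^⊕ a ⊕ C m ^⊕ a′
  B D : ℕ → Abelian
  B b = C (2 * m) ^⊕ b
  D c = C (6 * m) ^⊕ c

module _ (m t : ℕ) where

  invariantFactors : List ℕ
  invariantFactors = replicate (3 * t) m ++ replicate (4 * t) (2 * m) ++ replicate t (6 * m)

  J≅⨁C : J m t ≅ ⨁C invariantFactors
  J≅⨁C = ≅-trans (J m t) (⨁C ms ⊕ ⨁C (ms₂ ++ ms₆)) (⨁C invariantFactors)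
    (⊕-cong (C m ^⊕ (3 * t)) (⨁C ms) (C (2 * m) ^⊕ (4 * t) ⊕ C (6 * m) ^⊕ t) (⨁C (ms₂ ++ ms₆))
      (C^⊕≅⨁C m (3 * t))
      (≅-trans (C (2 * m) ^⊕ (4 * t) ⊕ C (6 * m) ^⊕ t) (⨁C ms₂ ⊕ ⨁C ms₆) (⨁C (ms₂ ++ ms₆))
        (⊕-cong (C (2 * m) ^⊕ (4 * t)) (⨁C ms₂) (C (6 * m) ^⊕ t) (⨁C ms₆)
          (C^⊕≅⨁C (2 * m) (4 * t)) (C^⊕≅⨁C (6 * m) t))
        (⨁C-++ ms₂ ms₆)))
    (⨁C-++ ms (ms₂ ++ ms₆))
    where
    ms = replicate (3 * t) m
    ms₂ = replicate (4 * t) (2 * m)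
    ms₆ = replicate t (6 * m)

  -- Divisibility is shown for all ordered pairs, not just neighbours: this form passes through
  -- concatenation even when a block is empty.
  invariantFactors-linked : Linked _∣_ invariantFactors
  invariantFactors-linked = Linked.AllPairs⇒Linked
    (AllPairs.++⁺ (constant (3 * t) m)
      (AllPairs.++⁺ (constant (4 * t) (2 * m)) (constant t (6 * m))
        (All.replicate⁺ (4 * t) (All.replicate⁺ t 2m∣6m)))
      (All.replicate⁺ (3 * t) (All.++⁺ (All.replicate⁺ (4 * t) (ℕᵈ.n∣m*n 2))
                                       (All.replicate⁺ t (ℕᵈ.n∣m*n 6)))))
    where
    constant : ∀ k n → AllPairs _∣_ (replicate k n)
    constant zero n = []
    constant (suc k) n = All.replicate⁺ k ℕᵈ.∣-refl ∷ constant k n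
    2m∣6m : 2 * m ∣ 6 * m
    2m∣6m = ℕᵈ.divides 3 (ℕ.*-assoc 3 2 m)

  d*-value : ℕ
  d*-value = 3 * t * pred m + (4 * t * pred (2 * m) + t * pred (6 * m))

  J-d* : 2 ≤ m → Is-d* (J m t) d*-value
  J-d* 1<m = invariantFactors ,
    All.++⁺ (All.replicate⁺ (3 * t) 1<m)
      (All.++⁺ (All.replicate⁺ (4 * t) (ℕ.<-≤-trans 1<m (ℕ.m≤n*m m 2)))
               (All.replicate⁺ t (ℕ.<-≤-trans 1<m (ℕ.m≤n*m m 6)))) ,
    invariantFactors-linked , J≅⨁C , ≡.sym d*-sum
    where
    block : ∀ k n ns → sum (map pred (replicate k n ++ ns)) ≡ k * pred n + sum (map pred ns)
    block zero n ns = refl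
    block (suc k) n ns = ≡.trans (cong (pred n ℕ.+_) (block k n ns)) (≡.sym (ℕ.+-assoc (pred n) _ _))

    last-block : ∀ k n → sum (map pred (replicate k n)) ≡ k * pred n
    last-block zero n = refl
    last-block (suc k) n = cong (pred n ℕ.+_) (last-block k n)

    d*-sum : sum (map pred invariantFactors) ≡ d*-value
    d*-sum = ≡.trans (block (3 * t) m _) (cong (3 * t * pred m ℕ.+_)
      (≡.trans (block (4 * t) (2 * m) _) (cong (4 * t * pred (2 * m) ℕ.+_) (last-block t (6 * m)))))

  J-generated : Generated (J m t) (8 * t)
  J-generated = subst (Generated (J m t)) (eq t)
    (⊕-generated (C m ^⊕ (3 * t)) (C (2 * m) ^⊕ (4 * t) ⊕ C (6 * m) ^⊕ t)
      (^⊕-generated (C m) (C-generated m) (3 * t))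
      (⊕-generated (C (2 * m) ^⊕ (4 * t)) (C (6 * m) ^⊕ t)
        (^⊕-generated (C (2 * m)) (C-generated (2 * m)) (4 * t))
        (^⊕-generated (C (6 * m)) (C-generated (6 * m)) t)))
    where
    eq : ∀ t → 3 * t + (4 * t + t) ≡ 8 * t
    eq = solve-∀

  -- The quotient of J by mJ, isomorphic to C_m^{8t}; the three blocks are kept so that the
  -- projection is built summand by summand.
  J/m : Abelian
  J/m = C m ^⊕ (3 * t) ⊕ C m ^⊕ (4 * t) ⊕ C m ^⊕ t

  J↠J/m : J m t ↠ J/m
  J↠J/m = ⊕-↠ (C m ^⊕ (3 * t)) (C m ^⊕ (3 * t))
              (C (2 * m) ^⊕ (4 * t) ⊕ C (6 * m) ^⊕ t) (C m ^⊕ (4 * t) ⊕ C m ^⊕ t)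
    (^⊕-↠ (C m) (C m) (C-↠ ℕᵈ.∣-refl) (3 * t))
    (⊕-↠ (C (2 * m) ^⊕ (4 * t)) (C m ^⊕ (4 * t)) (C (6 * m) ^⊕ t) (C m ^⊕ t)
      (^⊕-↠ (C (2 * m)) (C m) (C-↠ (ℕᵈ.n∣m*n 2)) (4 * t))
      (^⊕-↠ (C (6 * m)) (C m) (C-↠ (ℕᵈ.n∣m*n 6)) t))

  module _ .{{_ : NonZero m}} where

    private instance
      2m≢0 : NonZero (2 * m)
      2m≢0 = ℕ.m*n≢0 2 m
      6m≢0 : NonZero (6 * m)
      6m≢0 = ℕ.m*n≢0 6 m

    J-enumeration : Enumeration (m ^ (3 * t) * ((2 * m) ^ (4 * t) * (6 * m) ^ t)) (J m t)
    J-enumeration =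
      ⊕-enumeration (C m ^⊕ (3 * t)) (C (2 * m) ^⊕ (4 * t) ⊕ C (6 * m) ^⊕ t)
        (^⊕-enumeration (C m) (C-enumeration m) (3 * t))
        (⊕-enumeration (C (2 * m) ^⊕ (4 * t)) (C (6 * m) ^⊕ t)
          (^⊕-enumeration (C (2 * m)) (C-enumeration (2 * m)) (4 * t))
          (^⊕-enumeration (C (6 * m)) (C-enumeration (6 * m)) t))

    J/m-enumeration : Enumeration (m ^ (8 * t)) J/m
    J/m-enumeration = subst (λ N → Enumeration N J/m) eq
      (⊕-enumeration (C m ^⊕ (3 * t)) (C m ^⊕ (4 * t) ⊕ C m ^⊕ t)
        (^⊕-enumeration (C m) (C-enumeration m) (3 * t))
        (⊕-enumeration (C m ^⊕ (4 * t)) (C m ^⊕ t)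
          (^⊕-enumeration (C m) (C-enumeration m) (4 * t))
          (^⊕-enumeration (C m) (C-enumeration m) t)))
      where
      exponents : ∀ t → 3 * t + (4 * t + t) ≡ 8 * t
      exponents = solve-∀
      eq : m ^ (3 * t) * (m ^ (4 * t) * m ^ t) ≡ m ^ (8 * t)
      eq = ≡.trans (cong (m ^ (3 * t) *_) (≡.sym (ℕ.^-distribˡ-+-* m (4 * t) t)))
        (≡.trans (≡.sym (ℕ.^-distribˡ-+-* m (3 * t) (4 * t + t))) (cong (m ^_) (exponents t)))

    J/m-kills : Kills m J/m
    J/m-kills = ⊕-kills m (C m ^⊕ (3 * t)) (C m ^⊕ (4 * t) ⊕ C m ^⊕ t) (Cm-kills (3 * t))
      (⊕-kills m (C m ^⊕ (4 * t)) (C m ^⊕ t) (Cm-kills (4 * t)) (Cm-kills t))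
      where
      Cm-kills : ∀ k → Kills m (C m ^⊕ k)
      Cm-kills = ^⊕-kills m (C m) (∣⇒C-kills ℕᵈ.∣-refl)

    J-rank : 2 ≤ m → IsRank (J m t) (8 * t)
    -- With k < 8t generators at most m^k elements of `J/m` are reached, and m ≥ 2 makes this less
    -- than m^{8t}.
    J-rank 1<m = J-generated , λ k gen → ℕ.≮⇒≥ λ k<8t → ℕ.<⇒≱ (ℕ.^-monoʳ-< m 1<m k<8t)
      (generated-bound J/m m J/m-kills J/m-enumeration (↠-generated (J m t) J/m J↠J/m gen))

    J-kills : Kills (6 * m) (J m t)
    J-kills = ⊕-kills (6 * m) (C m ^⊕ (3 * t)) (C (2 * m) ^⊕ (4 * t) ⊕ C (6 * m) ^⊕ t)
      (^⊕-kills (6 * m) (C m) (∣⇒C-kills (ℕᵈ.n∣m*n 6)) (3 * t))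
      (⊕-kills (6 * m) (C (2 * m) ^⊕ (4 * t)) (C (6 * m) ^⊕ t)
        (^⊕-kills (6 * m) (C (2 * m)) (∣⇒C-kills (ℕᵈ.divides 3 (ℕ.*-assoc 3 2 m))) (4 * t))
        (^⊕-kills (6 * m) (C (6 * m)) (∣⇒C-kills ℕᵈ.∣-refl) t))

    J-zeroSumFree : HasZeroSumFree (J m t) (t * Vec.sum (multiplicities m bounds))
    J-zeroSumFree = subst₂ (λ a b → HasZeroSumFree (K m a b t) ℓt) (ℕ.*-comm t 3) (ℕ.*-comm t 4)
      (subst (λ c → HasZeroSumFree (K m (t * 3) (t * 4) c) ℓt) (ℕ.*-identityʳ t) (copies t))
      where
      ℓ = Vec.sum (multiplicities m bounds)
      ℓt = t * ℓ

      -- Exponents are written `t * 3` because `suc t * 3` reduces to `3 + t * 3`, the form that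
      -- adding one copy produces.
      copies : ∀ t → HasZeroSumFree (K m (t * 3) (t * 4) (t * 1)) (t * ℓ)
      copies zero = [] , refl , λ { [] ys≢[] _ → ys≢[] refl }
      copies (suc t) =
        K-zeroSumFree-+ m 3 4 1 (t * 3) (t * 4) (t * 1) (K-zeroSumFree m) (copies t)

-- The successor provides a summand `C (6 * m)`. Any e > 0 killing the group kills this summand, so
-- 6m divides e.
J-exponent : ∀ m t .{{_ : NonZero m}} → IsExponent (J m (suc t)) (6 * m)
J-exponent m t = (ℕ.>-nonZero⁻¹ (6 * m) {{ℕ.m*n≢0 6 m}} , J-kills m (suc t)) , λ e (e>0 , kills) →
  ℕᵈ.∣⇒≤ {{ℕ.>-nonZero e>0}} (C-kills⇒∣
    (⊕-kills⁻ˡ e (C (6 * m)) (C (6 * m) ^⊕ t)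
      (⊕-kills⁻ʳ e (C (2 * m) ^⊕ (4 * suc t)) (C (6 * m) ^⊕ suc t)
        (⊕-kills⁻ʳ e (C m ^⊕ (3 * suc t)) (C (2 * m) ^⊕ (4 * suc t) ⊕ C (6 * m) ^⊕ suc t) kills))))

length≡d*+tm : ∀ m t .{{_ : NonZero m}} →
               t * Vec.sum (multiplicities m bounds) ≡ t * m + d*-value m t
-- With m in successor form every `pred` computes, and a polynomial identity in a and t remains.
length≡d*+tm (suc a) t = identity a t
  where
  -- 18m − 8 = (17m − 8) + m, with m = 1 + a.
  identity : ∀ a t →
    let p₂ = a + ((1 + a) + 0)
        p₄ = a + ((1 + a) + ((1 + a) + ((1 + a) + 0)))
        p₆ = a + ((1 + a) + ((1 + a) + ((1 + a) + ((1 + a) + ((1 + a) + 0)))))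
    in t * (p₂ + (p₂ + (p₂ + (p₂ + (p₂ + (p₄ + (p₂ + (p₂ + 0))))))))
         ≡ t * (1 + a) + (3 * t * a + (4 * t * p₂ + t * p₆))
  identity = solve-∀

mainTheorem6 : ∀ (m t : ℕ) → m ≥ 2 → t ≥ 1 →
    ∃[ δ ] ∃[ r ] ∃[ e ]
    IsDavenportExcess (J m t) δ
    × IsRank (J m t) r
    × IsExponent (J m t) e
    × δ ≥ᶻ + (t * m)
    × + (t * m) / 1 ≡ + (r * e) / 48
mainTheorem6 m@(suc _) t@(suc t′) m≥2 _ =
  + d ℤ.- + d* , 8 * t , 6 * m ,
  (d , d* , d-is-d , J-d* m t m≥2 , refl) , J-rank m t m≥2 , J-exponent m t′ ,
  -- Since `d* ≤ d`, the integer excess is a truncated difference, and the bound reduces to one in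
  -- ℕ.
  subst (+ (t * m) ℤ.≤_)
    (≡.sym (≡.trans (ℤ.m-n≡m⊖n d d*) (ℤ.⊖-≥ (ℕ.≤-trans (ℕ.m≤n+m d* (t * m)) tm+d*≤d))))
    (+≤+ (ℕ.m+n≤o⇒m≤o∸n (t * m) tm+d*≤d)) ,
  -- `mkℚᵘ` stores the denominator minus one, so 0 and 47 encode the denominators 1 and 48.
  ℚ.fromℚᵘ-cong {ℚᵘ.mkℚᵘ (+ (t * m)) 0} {ℚᵘ.mkℚᵘ (+ (8 * t * (6 * m))) 47}
    (ℚᵘ.*≡* (≡.trans (≡.sym (ℤ.pos-* (t * m) 48))
      (≡.trans (cong +_ (48tm t m)) (≡.sym (ℤ.*-identityʳ _)))))
  where
  davenport : ∃ (Is-d (J m t))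
  davenport = d-exists (J m t) (J-enumeration m t)

  d d* : ℕ
  d = proj₁ davenport
  d* = d*-value m t

  d-is-d : Is-d (J m t) d
  d-is-d = proj₂ davenport

  tm+d*≤d : t * m + d* ≤ d
  -- The maximum is at least the length of the constructed sequence, which equals `t * m + d*`.
  tm+d*≤d = subst (_≤ d) (length≡d*+tm m t) (proj₂ d-is-d _ (J-zeroSumFree m t))

  48tm : ∀ t m → t * m * 48 ≡ 8 * t * (6 * m)
  48tm = solve-∀
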